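{- Let $a,b,c$ be nonzero real numbers, let $w_0,w_1$ be arbitrary real initial values, and let $\{w_n\}$ be the associated generalized bi-periodic Horadam sequence. Let $$U=\begin{pmatrix} ab & cb\\ a & 0\end{pmatrix},\qquad T=\begin{pmatrix} ab\,w_1+cb\,w_0 & cb\,w_1\\ a\,w_1 & cb\,w_0\end{pmatrix}.$$ Then for every integer $n$, $$TU^{n}=(ab)^{\lfloor (n+1)/2\rfloor}\begin{pmatrix} b^{\zeta(n+1)}w_{n+2} & c\,b\,a^{ -\zeta(n)}w_{n+1}\\ a^{\zeta(n+1)}w_{n+1} & c\,b^{\zeta(n+1)}w_{n}\end{pmatrix}.$$
   Context: For nonzero real numbers $a,b,c$ and real initial values $w_0,w_1$, the generalized bi-periodic Horadam sequence $\{w_n\}$ is defined by $w_n=\chi(n)w_{n-1}+c\,w_{n-2}$ for $n\ge 2$, where $\chi(n)=a$ if $n$ is even and $\chi(n)=b$ if $n$ is odd. It is extended to negative indices by $w_{ -n}=-\frac{a^{\zeta(n+1)}b^{\zeta(n)}}{c}w_{ -n+1}+\frac1c w_{ -n+2}$ for $n\ge1$ (i.e. the same recurrence run backwards). The parity function is $\zeta(n)=0$ if $n$ is even and $\zeta(n)=1$ if $n$ is odd. -}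

module Defs where

open import Algebra.Apartness.Bundles using (HeytingCommutativeRing; HeytingField)
open import Algebra.Bundles using (CommutativeRing; Semiring)
open import Algebra.Bundles.Raw using (RawMonoid)
open import Algebra.Definitions using (Invertible)
import Algebra.Definitions.RawMonoid as RawMonoidDefs
import Algebra.Definitions.RawSemiring as RawSemiringDefs
import Algebra.Apartness.Properties.HeytingCommutativeRing as HeytingProperties
import Algebra.Properties.Ring as RingProperties
import Algebra.Properties.CommutativeSemigroup as CommutativeSemigroupProperties
open import Data.Bool.Base using (if_then_else_)
open import Data.Fin.Base using (Fin; zero; suc)
open import Data.Fin.Properties using (_≟_)
open import Data.Integer.Base as ℤ using (ℤ; +_; -[1+_])
open import Data.Nat.Base as ℕ using (ℕ; suc)
open import Data.Product.Base using (∃-syntax; _×_; _,_; proj₁)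
open import Data.Sum.Base using (_⊎_)
open import Data.Vec.Functional using (Vector; []; _∷_)
open import Level using (_⊔_) renaming (suc to lsuc)
open import Relation.Binary.Core using (Rel)
open import Relation.Binary.Definitions using (Cotransitive)
open import Relation.Binary.Structures using (IsStrictPartialOrder)
import Relation.Binary.Reasoning.Setoid as SetoidReasoning
open import Relation.Nullary.Decidable.Core using (does)

-- The real numbers, axiomatised as a Cauchy-complete Archimedean ordered field
-- whose apartness is the one induced by the order.  Classically these axioms
-- determine ℝ up to isomorphism (and x # y is then just x ≉ y); constructively
-- they hold of Bishop's Cauchy reals and of the Dedekind reals.
record RealNumbers c ℓ₁ ℓ₂ : Set (lsuc (c ⊔ ℓ₁ ⊔ ℓ₂)) where
  field
    heytingField : HeytingField c ℓ₁ ℓ₂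

  open HeytingField heytingField public
  open CommutativeRing (HeytingCommutativeRing.commutativeRing heytingCommutativeRing)
    using (+-rawMonoid)
  open RawMonoidDefs +-rawMonoid using () renaming (_×_ to _·_)

  infix 4 _<_
  field
    _<_                  : Rel Carrier ℓ₂
    isStrictPartialOrder : IsStrictPartialOrder _≈_ _<_
    <-cotrans            : Cotransitive _<_
    #⇒<⊎>                : ∀ {x y} → x # y → x < y ⊎ y < x
    <⇒#                  : ∀ {x y} → x < y → x # y
    +-monoˡ-<            : ∀ {x y} z → x < y → x + z < y + z
    *-pos                : ∀ {x y} → 0# < x → 0# < y → 0# < x * y
    archimedean          : ∀ x → ∃[ n ] x < n · 1#

  Cauchy : (ℕ → Carrier) → Set (c ⊔ ℓ₂)
  Cauchy s = ∀ ε → 0# < ε →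
    ∃[ N ] (∀ m n → N ℕ.≤ m → N ℕ.≤ n → s m < s n + ε)

  _ConvergesTo_ : (ℕ → Carrier) → Carrier → Set (c ⊔ ℓ₂)
  s ConvergesTo l = ∀ ε → 0# < ε →
    ∃[ N ] (∀ n → N ℕ.≤ n → (s n < l + ε) × (l < s n + ε))

  field
    complete : ∀ s → Cauchy s → ∃[ l ] (s ConvergesTo l)

module IntegerPower {c ℓ} (M : RawMonoid c ℓ) where
  open RawMonoid M
  open RawMonoidDefs M using () renaming (_×_ to _·_)

  -- The library's n · x is the n-fold product of x, written additively.
  zpow : (x : Carrier) → Invertible _≈_ ε _∙_ x → ℤ → Carrier
  zpow x _         (+ n)    = n · x
  zpow x (x⁻¹ , _) -[1+ n ] = suc n · x⁻¹

ζ : ℤ → ℕ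
ζ n = n ℤ.%ℕ 2

module Field {r ℓ₁ ℓ₂} (F : HeytingField r ℓ₁ ℓ₂) where
  open HeytingField F
  open CommutativeRing (HeytingCommutativeRing.commutativeRing heytingCommutativeRing)
    using (semiring; *-rawMonoid)
  open HeytingProperties heytingCommutativeRing using (x-0≈x)
  open RawSemiringDefs (Semiring.rawSemiring semiring) public using (_^_; sum)

  #0⇒invertible : ∀ {x} → x # 0# → Invertible _≈_ 1# _*_ x
  #0⇒invertible {x} x#0 with #⇒invertible x#0
  ... | y , yx≈1 , xy≈1 =
    y , trans (*-congˡ (sym (x-0≈x x))) yx≈1 , trans (*-congʳ (sym (x-0≈x x))) xy≈1

  inv : (x : Carrier) → x # 0# → Carrier
  inv x x#0 = proj₁ (#0⇒invertible x#0)

  infixr 8 _^[_]_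
  _^[_]_ : (x : Carrier) → x # 0# → ℤ → Carrier
  x ^[ x#0 ] n = IntegerPower.zpow *-rawMonoid x (#0⇒invertible x#0) n

  Matrix : ℕ → Set r
  Matrix n = Vector (Vector Carrier n) n

  infix  4 _≈ᴹ_
  infixl 7 _*ᴹ_ _•_

  _≈ᴹ_ : ∀ {n} → Rel (Matrix n) ℓ₁
  A ≈ᴹ B = ∀ i j → A i j ≈ B i j

  _*ᴹ_ : ∀ {n} → Matrix n → Matrix n → Matrix n
  (A *ᴹ B) i j = sum (λ k → A i k * B k j)

  1ᴹ : ∀ {n} → Matrix n
  1ᴹ i j = if does (i ≟ j) then 1# else 0#

  _•_ : ∀ {n} → Carrier → Matrix n → Matrix n
  (x • A) i j = x * A i j

  *ᴹ-rawMonoid : ℕ → RawMonoid r ℓ₁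
  *ᴹ-rawMonoid n = record
    { Carrier = Matrix n ; _≈_ = _≈ᴹ_ ; _∙_ = _*ᴹ_ ; ε = 1ᴹ }

  InvertibleMatrix : ∀ {n} → Matrix n → Set (r ⊔ ℓ₁)
  InvertibleMatrix = Invertible _≈ᴹ_ 1ᴹ _*ᴹ_

  infixr 8 _^ᴹ[_]_
  _^ᴹ[_]_ : ∀ {m} (A : Matrix m) → InvertibleMatrix A → ℤ → Matrix m
  _^ᴹ[_]_ {m} = IntegerPower.zpow (*ᴹ-rawMonoid m)

  matrix₂ : Carrier → Carrier → Carrier → Carrier → Matrix 2
  matrix₂ p q r s = (p ∷ q ∷ []) ∷ (r ∷ s ∷ []) ∷ []

  module Horadam
    (a b c : Carrier) (a#0 : a # 0#) (b#0 : b # 0#) (c#0 : c # 0#)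
    where

    private
      c⁻¹ : Carrier
      c⁻¹ = inv c c#0

    χ : ℤ → Carrier
    χ n = if ζ n ℕ.≡ᵇ 0 then a else b

    -- w₋ₙ in terms of x = w₋ₙ₊₁ and y = w₋ₙ₊₂.
    back : ℤ → Carrier → Carrier → Carrier
    back n x y = - (a ^ ζ (n ℤ.+ ℤ.1ℤ) * b ^ ζ n * c⁻¹) * x + c⁻¹ * y

    w : (w₀ w₁ : Carrier) → ℤ → Carrier
    w w₀ w₁ (+ 0)              = w₀
    w w₀ w₁ (+ 1)              = w₁
    w w₀ w₁ (+ suc (suc n))    =
      χ (+ suc (suc n)) * w w₀ w₁ (+ suc n) + c * w w₀ w₁ (+ n)
    w w₀ w₁ -[1+ 0 ]           = back (+ 1) w₀ w₁
    w w₀ w₁ -[1+ 1 ]           = back (+ 2) (w w₀ w₁ -[1+ 0 ]) w₀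
    w w₀ w₁ -[1+ suc (suc n) ] =
      back (+ suc (suc (suc n))) (w w₀ w₁ -[1+ suc n ]) (w w₀ w₁ -[1+ n ])

    U : Matrix 2
    U = matrix₂ (a * b) (c * b)
                a       0#

    T : (w₀ w₁ : Carrier) → Matrix 2
    T w₀ w₁ = matrix₂ (a * b * w₁ + c * b * w₀) (c * b * w₁)
                      (a * w₁)                  (c * b * w₀)

    U-invertible : InvertibleMatrix U
    U-invertible with #0⇒invertible a#0 | #0⇒invertible b#0 | #0⇒invertible c#0
    ... | a⁻ , a⁻a , aa⁻ | b⁻ , b⁻b , bb⁻ | c⁻ , c⁻c , cc⁻ = U⁻¹ , left , right
      where
      open CommutativeRing (HeytingCommutativeRing.commutativeRing heytingCommutativeRing)
        using (ring; *-commutativeSemigroup)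
      open RingProperties ring using (-‿distribˡ-*; -‿distribʳ-*)
      open CommutativeSemigroupProperties *-commutativeSemigroup using (interchange)
      open SetoidReasoning setoid

      U⁻¹ : Matrix 2
      U⁻¹ = matrix₂ 0#        a⁻
                    (c⁻ * b⁻) (- c⁻)

      drop₁ : ∀ {x y z} → x ≈ 0# → y ≈ z → x + (y + 0#) ≈ z
      drop₁ p q = trans (+-cong p (trans (+-identityʳ _) q)) (+-identityˡ _)

      drop₂ : ∀ {x y z} → x ≈ z → y ≈ 0# → x + (y + 0#) ≈ z
      drop₂ p q = trans (+-cong p (trans (+-identityʳ _) q)) (+-identityʳ _)

      cancel : ∀ {x y z} → x ≈ z → y ≈ - z → x + (y + 0#) ≈ 0#
      cancel p q = trans (+-cong p (trans (+-identityʳ _) q)) (-‿inverseʳ _)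

      left : U⁻¹ *ᴹ U ≈ᴹ 1ᴹ
      left zero zero       = drop₁ (zeroˡ _) a⁻a
      left zero (suc zero) = drop₁ (zeroˡ _) (zeroʳ _)
      left (suc zero) zero = cancel
        (begin
          c⁻ * b⁻ * (a * b)   ≈⟨ interchange c⁻ b⁻ a b ⟩
          c⁻ * a * (b⁻ * b)   ≈⟨ *-congˡ b⁻b ⟩
          c⁻ * a * 1#         ≈⟨ *-identityʳ _ ⟩
          c⁻ * a              ∎)
        (sym (-‿distribˡ-* c⁻ a))
      left (suc zero) (suc zero) = drop₂
        (trans (interchange c⁻ b⁻ c b) (trans (*-cong c⁻c b⁻b) (*-identityˡ 1#)))
        (zeroʳ _)

      right : U *ᴹ U⁻¹ ≈ᴹ 1ᴹ
      right zero zero       = drop₁ (zeroʳ _)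
        (trans (interchange c b c⁻ b⁻) (trans (*-cong cc⁻ bb⁻) (*-identityˡ 1#)))
      right zero (suc zero) = cancel
        (begin
          a * b * a⁻          ≈⟨ *-congʳ (*-comm a b) ⟩
          b * a * a⁻          ≈⟨ *-assoc b a a⁻ ⟩
          b * (a * a⁻)        ≈⟨ *-congˡ aa⁻ ⟩
          b * 1#              ≈⟨ *-identityʳ b ⟩
          b                   ∎)
        (begin
          c * b * - c⁻        ≈⟨ -‿distribʳ-* (c * b) c⁻ ⟨
          - (c * b * c⁻)      ≈⟨ -‿cong (*-congʳ (*-comm c b)) ⟩
          - (b * c * c⁻)      ≈⟨ -‿cong (*-assoc b c c⁻) ⟩
          - (b * (c * c⁻))    ≈⟨ -‿cong (*-congˡ cc⁻) ⟩
          - (b * 1#)          ≈⟨ -‿cong (*-identityʳ b) ⟩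
          - b                 ∎)
      right (suc zero) zero       = drop₁ (zeroʳ _) (zeroˡ _)
      right (suc zero) (suc zero) = drop₂ aa⁻ (zeroˡ _)

{-# OPTIONS --safe #-}

-- Running the recurrence backwards inverts running it forwards, so the
-- recurrence holds at every integer index.  Consequently the right-hand side
-- R n satisfies R n · U = R (n + 1) for every integer n (a computation for each
-- parity of n), hence also R (n + 1) · U⁻¹ = R n; as R 0 = T, both T·Uⁿ = R n
-- and T·U⁻ⁿ = R (−n) follow by iteration.
module Submission where

open import Defs
open import Algebra.Apartness.Bundles using (HeytingCommutativeRing; HeytingField)
open import Algebra.Apartness.Properties.HeytingCommutativeRing using (x#0y#0→xy#0)
open import Algebra.Bundles using (CommutativeRing; Monoid)
open import Algebra.Definitions using (Invertible)
import Algebra.Definitions.RawMonoid as RawMonoidDefs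
import Algebra.Properties.Ring as RingProperties
import Algebra.Properties.Semiring.Sum as SumProperties
import Algebra.Solver.Ring.NaturalCoefficients.Default as SemiringSolver
open import Data.Bool.Base using (if_then_else_)
open import Data.Fin.Base using (zero; suc)
open import Data.Integer.Base as ℤ using (ℤ; +_; -[1+_]; 1ℤ)
import Data.Integer.Properties as ℤ
open import Data.Nat.Base as ℕ using (ℕ; zero; suc; s≤s)
open import Data.Nat.Divisibility using (divides-refl)
open import Data.Nat.DivMod using (m%n<n; m*n%n≡0; m*n/n≡m; [m+kn]%n≡m%n; +-distrib-/-∣ʳ)
open import Data.Product.Base using (_,_; proj₂)
open import Data.Vec.Functional using (Vector)
open import Function.Base using (_∘_)
import Relation.Binary.Reasoning.Setoid as SetoidReasoning
open import Relation.Binary.PropositionalEquality as ≡ using (_≡_)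

-- Parity of integers

-- Defined by constructors rather than as a product, so that `ℤ.suc`, `ζ` and `half` compute on it.
-- Since `-[1+ k ]` is -(k+1), its double -(2k+2) is `-[1+_]` of 2k+1.
double : ℤ → ℤ
double (+ k)    = + (k ℕ.* 2)
double -[1+ k ] = -[1+ suc (k ℕ.* 2) ]

double-suc : ∀ k → ℤ.suc (ℤ.suc (double k)) ≡ double (ℤ.suc k)
double-suc (+ k)        = ≡.refl
double-suc -[1+ 0 ]     = ≡.refl
double-suc -[1+ suc k ] = ≡.refl

double-pred : ∀ k → ℤ.pred (double k) ≡ ℤ.suc (double (ℤ.pred k))
double-pred (+ 0)     = ≡.refl
double-pred (+ suc k) = ≡.refl
double-pred -[1+ k ]  = ≡.refl

data Parity : ℤ → Set where
  even : ∀ k → Parity (double k)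
  odd  : ∀ k → Parity (ℤ.suc (double k))

parity-suc : ∀ {n} → Parity n → Parity (ℤ.suc n)
parity-suc (even k) = odd k
parity-suc (odd k)  = ≡.subst Parity (≡.sym (double-suc k)) (even (ℤ.suc k))

parity-pred : ∀ {n} → Parity n → Parity (ℤ.pred n)
parity-pred (even k) = ≡.subst Parity (≡.sym (double-pred k)) (odd (ℤ.pred k))
parity-pred (odd k)  = ≡.subst Parity (≡.sym (ℤ.pred-suc (double k))) (even k)

parity : ∀ n → Parity n
parity (+ 0)        = even (+ 0)
parity (+ suc n)    = parity-suc (parity (+ n))
-- -1 = 2·(-1) + 1.
parity -[1+ 0 ]     = odd -[1+ 0 ]
parity -[1+ suc n ] = parity-pred (parity -[1+ n ])

half : ℤ → ℤ
half n = n ℤ./ℕ 2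

k*2%2≡0 : ∀ k → k ℕ.* 2 ℕ.% 2 ≡ 0
k*2%2≡0 k = m*n%n≡0 k 2

1+k*2%2≡1 : ∀ k → suc (k ℕ.* 2) ℕ.% 2 ≡ 1
1+k*2%2≡1 k = [m+kn]%n≡m%n 1 k 2

1+k*2/2≡k : ∀ k → suc (k ℕ.* 2) ℕ./ 2 ≡ k
1+k*2/2≡k k = ≡.trans (+-distrib-/-∣ʳ 1 {d = 2} (divides-refl k)) (m*n/n≡m k 2)

ζ-double : ∀ k → ζ (double k) ≡ 0
ζ-double (+ k)    = k*2%2≡0 k
ζ-double -[1+ k ] rewrite k*2%2≡0 (suc k) = ≡.refl

ζ-suc-double : ∀ k → ζ (ℤ.suc (double k)) ≡ 1
ζ-suc-double (+ k)    = 1+k*2%2≡1 k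
ζ-suc-double -[1+ k ] rewrite 1+k*2%2≡1 k = ≡.refl

half-double : ∀ k → half (double k) ≡ k
half-double (+ k)    = ≡.cong +_ (m*n/n≡m k 2)
half-double -[1+ k ] rewrite k*2%2≡0 (suc k) = ≡.cong (ℤ.-_ ∘ +_) (m*n/n≡m (suc k) 2)

half-suc-double : ∀ k → half (ℤ.suc (double k)) ≡ k
half-suc-double (+ k)    = ≡.cong +_ (1+k*2/2≡k k)
-- Division of a negative integer branches on the remainder of its absolute value. Here the
-- remainder is 1, so the quotient is rounded down, to -(k+1).
half-suc-double -[1+ k ] rewrite 1+k*2%2≡1 k = ≡.cong -[1+_] (1+k*2/2≡k k)

ζ-suc-suc-double : ∀ k → ζ (ℤ.suc (ℤ.suc (double k))) ≡ 0
ζ-suc-suc-double k = ≡.trans (≡.cong ζ (double-suc k)) (ζ-double (ℤ.suc k))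

half-suc-suc-double : ∀ k → half (ℤ.suc (ℤ.suc (double k))) ≡ ℤ.suc k
half-suc-suc-double k = ≡.trans (≡.cong half (double-suc k)) (half-double (ℤ.suc k))

ζ-suc-suc-suc-double : ∀ k → ζ (ℤ.suc (ℤ.suc (ℤ.suc (double k)))) ≡ 1
ζ-suc-suc-suc-double k =
  ≡.trans (≡.cong (ζ ∘ ℤ.suc) (double-suc k)) (ζ-suc-double (ℤ.suc k))

half-suc-suc-suc-double : ∀ k → half (ℤ.suc (ℤ.suc (ℤ.suc (double k)))) ≡ ℤ.suc k
half-suc-suc-suc-double k =
  ≡.trans (≡.cong (half ∘ ℤ.suc) (double-suc k)) (half-suc-double (ℤ.suc k))

-- A remainder r > 0 becomes 2 - r under negation, and r = 1 is fixed. This reconciles `back`, which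
-- reads the parity of n to produce w₋ₙ, with the recurrence, which uses χ(-n).
ζ-neg : ∀ n → ζ -[1+ n ] ≡ ζ (+ suc n)
ζ-neg n with suc n ℕ.% 2 | m%n<n (suc n) 2
... | 0           | _            = ≡.refl
... | 1           | _            = ≡.refl
... | suc (suc _) | s≤s (s≤s ())

-- Integer powers in a monoid

module ZPow {m ℓ} (M : Monoid m ℓ) where
  open Monoid M
  open IntegerPower rawMonoid using (zpow)
  open RawMonoidDefs rawMonoid using () renaming (_×_ to _·_)
  open SetoidReasoning setoid

  cancelʳ : ∀ {x y} z → x ∙ y ≈ ε → (z ∙ x) ∙ y ≈ z
  cancelʳ z xy≈ε = trans (assoc z _ _) (trans (∙-congˡ xy≈ε) (identityʳ z))

  zpow-suc : ∀ x (inv : Invertible _≈_ ε _∙_ x) n →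
    zpow x inv (ℤ.suc n) ≈ x ∙ zpow x inv n
  zpow-suc x inv              (+ n)        = refl
  zpow-suc x (x⁻¹ , _ , xx⁻¹) -[1+ 0 ]     =
    sym (trans (∙-congˡ (identityʳ x⁻¹)) xx⁻¹)
  zpow-suc x (x⁻¹ , _ , xx⁻¹) -[1+ suc n ] = begin
    suc n · x⁻¹               ≈⟨ identityˡ _ ⟨
    ε ∙ (suc n · x⁻¹)         ≈⟨ ∙-congʳ xx⁻¹ ⟨
    (x ∙ x⁻¹) ∙ (suc n · x⁻¹) ≈⟨ assoc x x⁻¹ _ ⟩
    x ∙ (suc (suc n) · x⁻¹)   ∎

  -- The first factor of the power stands next to `f 0` after reassociation and turns it into `f 1`;
  -- the induction then continues with the shifted sequence.
  iterate : ∀ {x} (f : ℕ → Carrier) → (∀ n → f n ∙ x ≈ f (suc n)) →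
    ∀ n → f 0 ∙ (n · x) ≈ f n
  iterate     f step zero    = identityʳ (f 0)
  iterate {x} f step (suc n) = begin
    f 0 ∙ (x ∙ (n · x)) ≈⟨ assoc (f 0) x _ ⟨
    f 0 ∙ x ∙ (n · x)   ≈⟨ ∙-congʳ (step 0) ⟩
    f 1 ∙ (n · x)       ≈⟨ iterate (f ∘ suc) (step ∘ suc) n ⟩
    f (suc n)           ∎

  -- For negative exponents, `iterate` is applied to x⁻¹ and the sequence read backwards from 0. Its
  -- step comes from writing f(-k) as f(-k-1)·x and cancelling x against x⁻¹.
  zpow-iterate : ∀ {x} (inv : Invertible _≈_ ε _∙_ x) (f : ℤ → Carrier) →
    (∀ n → f n ∙ x ≈ f (ℤ.suc n)) → ∀ n → f (+ 0) ∙ zpow x inv n ≈ f n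
  zpow-iterate     inv              f step (+ n)    = iterate (f ∘ +_) (step ∘ +_) n
  zpow-iterate {x} (x⁻¹ , _ , xx⁻¹) f step -[1+ n ] =
    iterate (λ k → f (ℤ.- (+ k))) step⁻¹ (suc n)
    where
    step⁻¹ : ∀ k → f (ℤ.- (+ k)) ∙ x⁻¹ ≈ f -[1+ k ]
    step⁻¹ zero    = trans (∙-congʳ (sym (step -[1+ 0 ]))) (cancelʳ _ xx⁻¹)
    step⁻¹ (suc k) = trans (∙-congʳ (sym (step -[1+ suc k ]))) (cancelʳ _ xx⁻¹)

module FieldProperties {r ℓ₁ ℓ₂} (F : HeytingField r ℓ₁ ℓ₂) where
  open HeytingField F
  open CommutativeRing (HeytingCommutativeRing.commutativeRing heytingCommutativeRing)
    using (ring; semiring; commutativeSemiring; *-monoid)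
  open RingProperties ring using (-‿distribʳ-*)
  open SumProperties semiring
    using (sum-cong-≋; sum-replicate-zero; ∑-comm; *-distribˡ-sum; *-distribʳ-sum)
  open SemiringSolver commutativeSemiring using (solve; _:=_; _:+_; _:*_; con)
  open SetoidReasoning setoid
  open Field F

  -- Square matrices

  sum-zero : ∀ {n} {f : Vector Carrier n} → (∀ k → f k ≈ 0#) → sum f ≈ 0#
  sum-zero {n} f≈0 = trans (sum-cong-≋ f≈0) (sum-replicate-zero n)

  sum-*-1ᴹ : ∀ {n} (f : Vector Carrier n) j → sum (λ k → f k * 1ᴹ k j) ≈ f j
  sum-*-1ᴹ f zero    =
    trans (+-cong (*-identityʳ _) (sum-zero (λ k → zeroʳ (f (suc k))))) (+-identityʳ _)
  sum-*-1ᴹ f (suc j) =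
    -- The entries of `1ᴹ` at two successor indices reduce to those at their predecessors, so the
    -- tail is the same sum one size smaller.
    trans (+-cong (zeroʳ _) (sum-*-1ᴹ (f ∘ suc) j)) (+-identityˡ _)

  sum-1ᴹ-* : ∀ {n} (f : Vector Carrier n) i → sum (λ k → 1ᴹ i k * f k) ≈ f i
  sum-1ᴹ-* f zero    =
    trans (+-cong (*-identityˡ _) (sum-zero (λ k → zeroˡ (f (suc k))))) (+-identityʳ _)
  sum-1ᴹ-* f (suc i) =
    trans (+-cong (zeroˡ _) (sum-1ᴹ-* (f ∘ suc) i)) (+-identityˡ _)

  *ᴹ-assoc : ∀ {n} (A B C : Matrix n) → (A *ᴹ B) *ᴹ C ≈ᴹ A *ᴹ (B *ᴹ C)
  *ᴹ-assoc A B C i j = begin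
    sum (λ k → sum (λ l → A i l * B l k) * C k j)
      ≈⟨ sum-cong-≋ (λ k → *-distribʳ-sum (C k j) (λ l → A i l * B l k)) ⟩
    sum (λ k → sum (λ l → A i l * B l k * C k j))
      ≈⟨ ∑-comm (λ k l → A i l * B l k * C k j) ⟩
    sum (λ l → sum (λ k → A i l * B l k * C k j))
      ≈⟨ sum-cong-≋ (λ l → sum-cong-≋ (λ k → *-assoc (A i l) (B l k) (C k j))) ⟩
    sum (λ l → sum (λ k → A i l * (B l k * C k j)))
      ≈⟨ sum-cong-≋ (λ l → *-distribˡ-sum (A i l) (λ k → B l k * C k j)) ⟨
    sum (λ l → A i l * sum (λ k → B l k * C k j)) ∎

  *ᴹ-monoid : ℕ → Monoid r ℓ₁
  *ᴹ-monoid n = record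
    { Carrier  = Matrix n
    ; _≈_      = _≈ᴹ_
    ; _∙_      = _*ᴹ_
    ; ε        = 1ᴹ
    ; isMonoid = record
      { isSemigroup = record
        { isMagma = record
          { isEquivalence = record
            { refl  = λ i j → refl
            ; sym   = λ p i j → sym (p i j)
            ; trans = λ p q i j → trans (p i j) (q i j)
            }
          ; ∙-cong = λ p q i j → sum-cong-≋ (λ k → *-cong (p i k) (q k j))
          }
        ; assoc = *ᴹ-assoc
        }
      ; identity = (λ A i j → sum-1ᴹ-* (λ k → A k j) i)
                 , (λ A i j → sum-*-1ᴹ (A i) j)
      }
    }

  module HoradamProperties
    (a b c : Carrier) (a#0 : a # 0#) (b#0 : b # 0#) (c#0 : c # 0#)
    (w₀ w₁ : Carrier)
    where
    open Horadam a b c a#0 b#0 c#0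

    private
      W : ℤ → Carrier
      W = w w₀ w₁

      a⁻¹ c⁻¹ : Carrier
      a⁻¹ = inv a a#0
      c⁻¹ = inv c c#0

      aa⁻¹≈1 : a * a⁻¹ ≈ 1#
      aa⁻¹≈1 = proj₂ (proj₂ (#0⇒invertible a#0))

      cc⁻¹≈1 : c * c⁻¹ ≈ 1#
      cc⁻¹≈1 = proj₂ (proj₂ (#0⇒invertible c#0))

      ab#0 : a * b # 0#
      ab#0 = x#0y#0→xy#0 heytingCommutativeRing a#0 b#0

    -- The recurrence at every integer index

    χ-even : ∀ k → χ (double k) ≡ a
    χ-even k rewrite ζ-double k = ≡.refl

    χ-odd : ∀ k → χ (ℤ.suc (double k)) ≡ b
    χ-odd k rewrite ζ-suc-double k = ≡.refl

    χ-neg : ∀ n → χ -[1+ n ] ≡ χ (+ suc n)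
    χ-neg n = ≡.cong (λ z → if z ℕ.≡ᵇ 0 then a else b) (ζ-neg n)

    χ-formula : ∀ n → a ^ ζ (n ℤ.+ 1ℤ) * b ^ ζ n ≈ χ n
    χ-formula n rewrite ℤ.+-comm n 1ℤ with parity n
    ... | even k rewrite ζ-double k | ζ-suc-double k =
      trans (*-identityʳ _) (*-identityʳ a)
    ... | odd k rewrite ζ-suc-double k | ζ-suc-suc-double k =
      trans (*-identityˡ _) (*-identityʳ b)

    -- After expanding `back`, the coefficient of x is χ(n) - χ(n)·c·c⁻¹ = 0 and that of y is c·c⁻¹
    -- = 1.
    back-recurrence : ∀ n x y → y ≈ χ n * x + c * back n x y
    back-recurrence n x y = sym (begin
      χ n * x + c * (u * x + c⁻¹ * y)
        ≈⟨ solve 6 (λ χ c u c⁻¹ x y →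
             χ :* x :+ c :* (u :* x :+ c⁻¹ :* y) :=
             (χ :+ c :* u) :* x :+ (c :* c⁻¹) :* y) refl (χ n) c u c⁻¹ x y ⟩
      (χ n + c * u) * x + (c * c⁻¹) * y
        ≈⟨ +-cong (*-congʳ χ+cu≈0) (*-congʳ cc⁻¹≈1) ⟩
      0# * x + 1# * y
        ≈⟨ solve 2 (λ x y → con 0 :* x :+ con 1 :* y := y) refl x y ⟩
      y ∎)
      where
      v = a ^ ζ (n ℤ.+ 1ℤ) * b ^ ζ n
      -- The solver works over commutative semirings, so the negated coefficient is passed to it as
      -- an atom.
      u = - (v * c⁻¹)

      χ+cu≈0 : χ n + c * u ≈ 0#
      χ+cu≈0 = begin
        χ n + c * u             ≈⟨ +-congˡ (-‿distribʳ-* c (v * c⁻¹)) ⟨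
        χ n - c * (v * c⁻¹)     ≈⟨ +-congˡ (-‿cong (solve 3 (λ c v c⁻¹ →
                                     c :* (v :* c⁻¹) := v :* (c :* c⁻¹)) refl c v c⁻¹)) ⟩
        χ n - v * (c * c⁻¹)     ≈⟨ +-congˡ (-‿cong (*-cong (χ-formula n) cc⁻¹≈1)) ⟩
        χ n - χ n * 1#          ≈⟨ +-congˡ (-‿cong (*-identityʳ (χ n))) ⟩
        χ n - χ n               ≈⟨ -‿inverseʳ (χ n) ⟩
        0#                      ∎

    recurrence : ∀ n → W (ℤ.suc (ℤ.suc n)) ≈ χ n * W (ℤ.suc n) + c * W n
    -- Remainders modulo 2 compute through two successors, so χ(n+2) in the definition of `w` is
    -- already χ(n).
    recurrence (+ n)        = refl
    -- At -1 and -2 the parities are closed terms and χ(-n) = χ(n) by computation; an open index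
    -- requires `χ-neg`.
    recurrence -[1+ 0 ]     = back-recurrence (+ 1) _ _
    recurrence -[1+ 1 ]     = back-recurrence (+ 2) _ _
    recurrence n@(-[1+ suc (suc m) ]) rewrite χ-neg (suc (suc m)) =
      back-recurrence (+ suc (suc (suc m))) _ _

    -- The common shape of the right-hand sides for even n (s = 1, t = 0) and
    -- odd n (s = 0, t = 1), where x, y, z stand for wₙ, wₙ₊₁, wₙ₊₂.
    S : (s t : ℕ) (p x y z : Carrier) → Matrix 2
    S s t p x y z = p •
      matrix₂ (b ^ s * z) (c * b * a ^[ a#0 ] (ℤ.- (+ t)) * y)
              (a ^ s * y) (c * b ^ s * x)

    -- From even n to n+1 the exponent ⌊(n+1)/2⌋ rises by one, so every entry must release a factor
    -- ab. The top-right entry lacks the a, and a·a⁻¹ is inserted there; this is the source of the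
    -- negative power of a.
    S-even-step : ∀ {p p′ x y z z′} →
      p′ ≈ a * b * p → z ≈ a * y + c * x → z′ ≈ b * z + c * y →
      S 1 0 p x y z *ᴹ U ≈ᴹ S 0 1 p′ y z z′
    S-even-step {p} {y = y} {z} p′≈ _ z′≈ zero zero =
      trans
        -- The factors `con 1` come from unfolded powers (a first power is `b * 1#`, a zeroth is
        -- `1#`), and the final `con 0` from the empty tail of the sum.
        (solve 6 (λ a b c p y z →
           p :* (b :* con 1 :* z) :* (a :* b) :+ (p :* (c :* b :* con 1 :* y) :* a :+ con 0) :=
           a :* b :* p :* (con 1 :* (b :* z :+ c :* y))) refl a b c p y z)
        (sym (*-cong p′≈ (*-congˡ z′≈)))
    S-even-step {p} {p′} {y = y} {z} p′≈ _ _ zero (suc zero) = begin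
      _ ≈⟨ solve 5 (λ b c p y z →
             p :* (b :* con 1 :* z) :* (c :* b) :+ (p :* (c :* b :* con 1 :* y) :* con 0 :+ con 0) :=
             con 1 :* (b :* p :* c :* b :* z)) refl b c p y z ⟩
      1# * (b * p * c * b * z)               ≈⟨ *-congʳ aa⁻¹≈1 ⟨
      a * a⁻¹ * (b * p * c * b * z)
        ≈⟨ solve 6 (λ a a⁻¹ b c p z →
             a :* a⁻¹ :* (b :* p :* c :* b :* z) :=
             a :* b :* p :* (c :* b :* (a⁻¹ :* con 1) :* z)) refl a a⁻¹ b c p z ⟩
      a * b * p * (c * b * (a⁻¹ * 1#) * z)   ≈⟨ *-congʳ p′≈ ⟨
      p′ * (c * b * (a⁻¹ * 1#) * z)          ∎
    S-even-step {p} {x = x} {y} p′≈ z≈ _ (suc zero) zero =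
      trans
        (solve 6 (λ a b c p x y →
           p :* (a :* con 1 :* y) :* (a :* b) :+ (p :* (c :* (b :* con 1) :* x) :* a :+ con 0) :=
           a :* b :* p :* (con 1 :* (a :* y :+ c :* x))) refl a b c p x y)
        (sym (*-cong p′≈ (*-congˡ z≈)))
    S-even-step {p} {x = x} {y} p′≈ _ _ (suc zero) (suc zero) =
      trans
        (solve 6 (λ a b c p x y →
           p :* (a :* con 1 :* y) :* (c :* b) :+ (p :* (c :* (b :* con 1) :* x) :* con 0 :+ con 0) :=
           a :* b :* p :* (c :* con 1 :* y)) refl a b c p x y)
        (sym (*-congʳ p′≈))

    -- From odd n to n+1 the exponent ⌊(n+1)/2⌋ is unchanged. In the top-left entry the a⁻¹
    -- introduced by the preceding step cancels against the a of `U`.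
    S-odd-step : ∀ {p x y z z′} →
      z ≈ b * y + c * x → z′ ≈ a * z + c * y →
      S 0 1 p x y z *ᴹ U ≈ᴹ S 1 0 p y z z′
    S-odd-step {p} {y = y} {z} {z′} _ z′≈ zero zero = begin
      _ ≈⟨ solve 7 (λ a a⁻¹ b c p y z →
             p :* (con 1 :* z) :* (a :* b) :+
               (p :* (c :* b :* (a⁻¹ :* con 1) :* y) :* a :+ con 0) :=
             p :* (b :* (a :* z)) :+ a :* a⁻¹ :* (p :* (b :* (c :* y)))) refl a a⁻¹ b c p y z ⟩
      p * (b * (a * z)) + a * a⁻¹ * (p * (b * (c * y))) ≈⟨ +-congˡ (*-congʳ aa⁻¹≈1) ⟩
      p * (b * (a * z)) + 1# * (p * (b * (c * y)))
        ≈⟨ solve 6 (λ a b c p y z →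
             p :* (b :* (a :* z)) :+ con 1 :* (p :* (b :* (c :* y))) :=
             p :* (b :* con 1 :* (a :* z :+ c :* y))) refl a b c p y z ⟩
      p * (b * 1# * (a * z + c * y)) ≈⟨ *-congˡ (*-congˡ z′≈) ⟨
      p * (b * 1# * z′) ∎
    S-odd-step {p} {y = y} {z} _ _ zero (suc zero) =
      solve 6 (λ a⁻¹ b c p y z →
        p :* (con 1 :* z) :* (c :* b) :+
          (p :* (c :* b :* (a⁻¹ :* con 1) :* y) :* con 0 :+ con 0) :=
        p :* (c :* b :* con 1 :* z)) refl a⁻¹ b c p y z
    S-odd-step {p} {x} {y} z≈ _ (suc zero) zero =
      trans
        (solve 6 (λ a b c p x y →
           p :* (con 1 :* y) :* (a :* b) :+ (p :* (c :* con 1 :* x) :* a :+ con 0) :=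
           p :* (a :* con 1 :* (b :* y :+ c :* x))) refl a b c p x y)
        (sym (*-congˡ (*-congˡ z≈)))
    S-odd-step {p} {x} {y} _ _ (suc zero) (suc zero) =
      solve 5 (λ b c p x y →
        p :* (con 1 :* y) :* (c :* b) :+ (p :* (c :* con 1 :* x) :* con 0 :+ con 0) :=
        p :* (c :* (b :* con 1) :* y)) refl b c p x y

    -- The right-hand side of the theorem, with n+1 and n+2 as iterated `ℤ.suc`, the form that the
    -- parity lemmas and `zpow-iterate` expect.
    R : ℤ → Matrix 2
    R n = S (ζ (ℤ.suc n)) (ζ n) ((a * b) ^[ ab#0 ] half (ℤ.suc n))
            (W n) (W (ℤ.suc n)) (W (ℤ.suc (ℤ.suc n)))

    recurrence-even : ∀ k → let n = double k in
      W (ℤ.suc (ℤ.suc n)) ≈ a * W (ℤ.suc n) + c * W n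
    recurrence-even k =
      trans (recurrence (double k)) (+-congʳ (*-congʳ (reflexive (χ-even k))))

    recurrence-odd : ∀ k → let n = ℤ.suc (double k) in
      W (ℤ.suc (ℤ.suc n)) ≈ b * W (ℤ.suc n) + c * W n
    recurrence-odd k =
      trans (recurrence (ℤ.suc (double k))) (+-congʳ (*-congʳ (reflexive (χ-odd k))))

    recurrence-even′ : ∀ k → let n = ℤ.suc (ℤ.suc (double k)) in
      W (ℤ.suc (ℤ.suc n)) ≈ a * W (ℤ.suc n) + c * W n
    recurrence-even′ k rewrite double-suc k = recurrence-even (ℤ.suc k)

    R-step : ∀ n → R n *ᴹ U ≈ᴹ R (ℤ.suc n)
    R-step n with parity n
    ... | even k
      rewrite ζ-double k | ζ-suc-double k | ζ-suc-suc-double k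
            | half-suc-double k | half-suc-suc-double k =
      -- The exponent goes from k to k+1, which supplies the factor ab.
      S-even-step (ZPow.zpow-suc *-monoid (a * b) (#0⇒invertible ab#0) k)
        (recurrence-even k) (recurrence-odd k)
    ... | odd k
      rewrite ζ-suc-double k | ζ-suc-suc-double k | ζ-suc-suc-suc-double k
            | half-suc-suc-double k | half-suc-suc-suc-double k =
      -- Both 2k+2 and 2k+3 have half k+1, so the power of ab is shared.
      S-odd-step (recurrence-odd k) (recurrence-even′ k)

    T≈R0 : T w₀ w₁ ≈ᴹ R (+ 0)
    -- w₂ unfolds to a·w₁ + c·w₀, and the exponent of ab is 0.
    T≈R0 zero       zero       = solve 5 (λ a b c x y →
      a :* b :* y :+ c :* b :* x := con 1 :* (b :* con 1 :* (a :* y :+ c :* x)))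
      refl a b c w₀ w₁
    T≈R0 zero       (suc zero) = solve 3 (λ b c y →
      c :* b :* y := con 1 :* (c :* b :* con 1 :* y)) refl b c w₁
    T≈R0 (suc zero) zero       = solve 2 (λ a y →
      a :* y := con 1 :* (a :* con 1 :* y)) refl a w₁
    T≈R0 (suc zero) (suc zero) = solve 3 (λ b c x →
      c :* b :* x := con 1 :* (c :* (b :* con 1) :* x)) refl b c w₀

    T*Uⁿ≈R : ∀ n → T w₀ w₁ *ᴹ U ^ᴹ[ U-invertible ] n ≈ᴹ R n
    T*Uⁿ≈R n =
      M.trans {T w₀ w₁ *ᴹ Uⁿ} {R (+ 0) *ᴹ Uⁿ} {R n}
        (M.∙-congʳ {x = Uⁿ} T≈R0)
        (ZPow.zpow-iterate (*ᴹ-monoid 2) {U} U-invertible R R-step n)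
      where
      module M = Monoid (*ᴹ-monoid 2)
      Uⁿ = U ^ᴹ[ U-invertible ] n

mainTheorem2 :
    ∀ {r ℓ₁ ℓ₂} (ℝ : RealNumbers r ℓ₁ ℓ₂) →
    let open RealNumbers ℝ
        open Field heytingField in
    (a b c : Carrier) (a#0 : a # 0#) (b#0 : b # 0#) (c#0 : c # 0#) →
    (w₀ w₁ : Carrier) →
    let open Horadam a b c a#0 b#0 c#0
        ab#0 = x#0y#0→xy#0 heytingCommutativeRing a#0 b#0
        W = w w₀ w₁ in
    (n : ℤ) →
    T w₀ w₁ *ᴹ U ^ᴹ[ U-invertible ] n
      ≈ᴹ
    ((a * b) ^[ ab#0 ] ((n ℤ.+ 1ℤ) ℤ./ℕ 2)) •
      matrix₂ (b ^ ζ (n ℤ.+ 1ℤ) * W (n ℤ.+ + 2)) (c * b * a ^[ a#0 ] (ℤ.- (+ ζ n)) * W (n ℤ.+ 1ℤ))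
              (a ^ ζ (n ℤ.+ 1ℤ) * W (n ℤ.+ 1ℤ))  (c * b ^ ζ (n ℤ.+ 1ℤ) * W n)
mainTheorem2 ℝ a b c a#0 b#0 c#0 w₀ w₁ n
  -- This turns n+1 and n+2 into the `ℤ.suc` forms used in `R`.
  rewrite ℤ.+-comm n 1ℤ | ℤ.+-comm n (+ 2) | ℤ.+-assoc 1ℤ 1ℤ n =
  FieldProperties.HoradamProperties.T*Uⁿ≈R (RealNumbers.heytingField ℝ)
    a b c a#0 b#0 c#0 w₀ w₁ n
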